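{- If $G=(V,E)$ is a tree and $|V|\ge 3$, then $\widetilde{\chi}(G)=2$.
   Context: Graphs are finite and without loops. For $x\in V$, $E(x)$ denotes the set of edges of $G$ incident to $x$. For an integer $m\ge 2$, an $m$-homogeneous edge-coloring of $G$ is a map $c\colon E\to S$, where $S$ is a set of colors with $|S|=m$ ($c$ is not required to be surjective or proper), such that for every $x\in V$, writing $|E(x)|=m q_x+r_x$ with $0\le r_x<m$, exactly $r_x$ of the colors in $S$ are each assigned to exactly $q_x+1$ edges of $E(x)$, and each of the other $m-r_x$ colors is assigned to exactly $q_x$ edges of $E(x)$. (In particular, if $|E(x)|<m$, the edges of $E(x)$ have pairwise different colors.) The homogeneous chromatic index $\widetilde{\chi}(G)$ is the minimum integer $m\ge 2$ such that $G$ admits an $m$-homogeneous edge-coloring. -}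

module Defs where

open import Data.Nat using (ℕ; suc; _+_; _*_; _≤_; _<_)
open import Data.Fin using (Fin; _≟_)
open import Data.Fin.Subset using (Subset; ∣_∣; _∩_; _∈_; _∉_)
open import Data.List using (List; []; _∷_; length)
open import Data.List.Relation.Unary.Unique.Propositional using (Unique)
open import Data.Product using (_×_; ∃-syntax)
open import Data.Sum using (_⊎_)
open import Data.Vec using (tabulate)
open import Relation.Binary.PropositionalEquality using (_≡_; _≢_)
open import Relation.Nullary using (¬_; Dec; does; _⊎-dec_)

-- Edges have their own identity, so parallel edges are allowed; only loops are
-- excluded. Edges are undirected: the order of the two ends is mere
-- bookkeeping, and everything below is symmetric in them.
record Graph : Set where
  field
    order    : ℕ
    size     : ℕ
    end₁     : Fin size → Fin order
    end₂     : Fin size → Fin order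
    loopless : ∀ e → end₁ e ≢ end₂ e

  Vertex : Set
  Vertex = Fin order

  Edge : Set
  Edge = Fin size

  Incident : Vertex → Edge → Set
  Incident x e = end₁ e ≡ x ⊎ end₂ e ≡ x

  incident? : ∀ x e → Dec (Incident x e)
  incident? x e = (end₁ e ≟ x) ⊎-dec (end₂ e ≟ x)

  Joins : Edge → Vertex → Vertex → Set
  Joins e x y = (end₁ e ≡ x × end₂ e ≡ y) ⊎ (end₁ e ≡ y × end₂ e ≡ x)

  E : Vertex → Subset size
  E x = tabulate λ e → does (incident? x e)

  data Walk : Vertex → Vertex → Set where
    nil  : ∀ {x} → Walk x x
    cons : ∀ {x y z} (e : Edge) → Joins e x y → Walk y z → Walk x z

  edges : ∀ {x y} → Walk x y → List Edge
  edges nil          = []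
  edges (cons e _ w) = e ∷ edges w

  -- All vertices visited except the final one, so that on a closed walk the
  -- base point is listed once.
  vertices : ∀ {x y} → Walk x y → List Vertex
  vertices nil                  = []
  vertices (cons {x = x} _ _ w) = x ∷ vertices w

  -- Distinctness of edges rules out traversing one edge back and forth, while
  -- two parallel edges do form a cycle (of length 2).
  IsCycle : ∀ {x} → Walk x x → Set
  IsCycle w = 1 ≤ length (edges w) × Unique (edges w) × Unique (vertices w)

  Acyclic : Set
  Acyclic = ∀ {x} (w : Walk x x) → ¬ IsCycle w

  Connected : Set
  Connected = 1 ≤ order × (∀ x y → Walk x y)

  IsTree : Set
  IsTree = Connected × Acyclic

module _ (G : Graph) where
  open Graph G

  colourClass : ∀ {m} → (Edge → Fin m) → Fin m → Subset size
  colourClass c s = tabulate λ e → does (c e ≟ s)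

  -- T is the set of the r colours that occur q + 1 times at x.
  IsHomogeneous : (m : ℕ) → (Edge → Fin m) → Set
  IsHomogeneous m c = ∀ x →
    ∃[ q ] ∃[ r ] ∣ E x ∣ ≡ m * q + r × r < m ×
      (∃[ T ] ∣ T ∣ ≡ r
        × (∀ s → s ∈ T → ∣ E x ∩ colourClass c s ∣ ≡ suc q)
        × (∀ s → s ∉ T → ∣ E x ∩ colourClass c s ∣ ≡ q))

  HomogeneouslyColourable : ℕ → Set
  HomogeneouslyColourable m = ∃[ c ] IsHomogeneous m c

  -- "χ̃(G) = m", the minimum being expressed as a relation.
  HomogeneousChromaticIndex : ℕ → Set
  HomogeneousChromaticIndex m =
    (2 ≤ m × HomogeneouslyColourable m)
    × (∀ k → 2 ≤ k → HomogeneouslyColourable k → m ≤ k)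

{-# OPTIONS --safe #-}
-- Delete an edge uv of a forest G. Acyclicity puts u and v in different
-- components of G − uv, which has a balanced 2-colouring by induction. Some
-- colour may be added at u without unbalancing it, and some colour at v; if the
-- two differ, exchange the colours throughout the component of v. Then one
-- colour suits both ends and can be given to uv.
module Submission where

open import Data.Bool using (Bool; true; false; not; if_then_else_)
open import Data.Fin using (Fin; zero; suc; _≟_; opposite)
open import Data.Fin.Properties using (suc-injective; opposite-involutive)
open import Data.Fin.Subset using (∣_∣; _∩_; ⊥; ⁅_⁆) renaming (_∈_ to _∈ₛ_; _∉_ to _∉ₛ_)
open import Data.Fin.Subset.Properties using (∉⊥; ∣⊥∣≡0; ∣⁅x⁆∣≡1; x∈⁅x⁆; x∈⁅y⁆⇒x≡y)
open import Data.List using (List; _∷_; _∷ʳ_; map)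
open import Data.List.Membership.Propositional using (_∈_)
open import Data.List.Relation.Binary.Permutation.Propositional.Properties using (∷↭∷ʳ)
open import Data.List.Relation.Binary.Permutation.Propositional using (↭-sym; ↭⇒↭ₛ)
import Data.List.Relation.Binary.Permutation.Setoid.Properties as Permutation
open import Data.List.Relation.Unary.All using (All; []; _∷_; lookup; universal)
open import Data.List.Relation.Unary.All.Properties using (¬Any⇒All¬; map⁺)
open import Data.List.Relation.Unary.AllPairs using ([]; _∷_)
open import Data.List.Relation.Unary.Any using (here; there)
open import Data.List.Relation.Unary.Unique.Propositional using (Unique)
import Data.List.Relation.Unary.Unique.Propositional.Properties as Unique
open import Data.Nat using (ℕ; suc; _+_; _*_; _≤_; z≤n; s≤s)
open import Data.Nat.Properties using (+-suc)
open import Data.Nat.Tactic.RingSolver using (solve-∀)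
open import Data.Product using (Σ-syntax; ∃-syntax; _×_; _,_)
open import Data.Sum using (inj₁; inj₂)
open import Data.Vec as Vec using (tabulate)
open import Data.Vec.Functional using () renaming (_∷_ to infixr 5 _◁_)
open import Function using (_∘_)
open import Relation.Binary.PropositionalEquality
open import Relation.Nullary using (¬_; yes; no; does; proof; Reflects; invert; contradiction)
open import Relation.Nullary.Decidable using (dec-true; dec-false)
open import Defs

private variable
  n o : ℕ

-- Induction on the number of edges

graph : (s t : Fin n → Fin o) → (∀ e → s e ≢ t e) → Graph
graph s t s≢t = record { end₁ = s ; end₂ = t ; loopless = s≢t }

-- The step removes the edge numbered `zero` and keeps every vertex, so both end maps just lose
-- their first value. Spelling the graph out by its fields lets `go` recurse on the number of edges.
edge-induction : (P : Graph → Set) →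
  (∀ {o} {s t : Fin 0 → Fin o} {s≢t} → P (graph s t s≢t)) →
  (∀ {n o} {s t : Fin (suc n) → Fin o} {s≢t} →
     P (graph (s ∘ suc) (t ∘ suc) (s≢t ∘ suc)) → P (graph s t s≢t)) →
  ∀ G → P G
edge-induction P base step G = go _ _ _
  where
  go : (s t : Fin n → Fin o) (s≢t : ∀ e → s e ≢ t e) → P (graph s t s≢t)
  go {n = 0}     s t s≢t = base
  go {n = suc _} s t s≢t = step (go (s ∘ suc) (t ∘ suc) (s≢t ∘ suc))

-- Walks, paths and components

module _ {G : Graph} where
  open Graph G
  open import Data.List.Membership.DecPropositional {A = Vertex} _≟_ using (_∈?_)

  infixr 5 _⁀_
  _⁀_ : ∀ {x y z} → Walk x y → Walk y z → Walk x z
  nil        ⁀ w′ = w′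
  cons e j w ⁀ w′ = cons e j (w ⁀ w′)

  -- A path must also avoid returning to its final vertex, which `vertices` leaves out.
  visited : ∀ {x y} → Walk x y → List Vertex
  visited {y = y} w = vertices w ∷ʳ y

  IsPath : ∀ {x y} → Walk x y → Set
  IsPath w = Unique (visited w)

  path-suffix : ∀ {x y z} (p : Walk y z) → IsPath p → x ∈ visited p →
                ∃[ q ] IsPath {x} {z} q
  path-suffix nil          u       (here refl) = nil , u
  path-suffix (cons e j p) u       (here refl) = cons e j p , u
  path-suffix (cons e j p) (_ ∷ u) (there x∈p) = path-suffix p u x∈p

  -- Shorten the tail to a path first. If `x` already lies on that path, its part from `x` onwards
  -- is the answer; otherwise the first edge can be put in front.
  walk⇒path : ∀ {x y} → Walk x y → ∃[ p ] IsPath {x} {y} p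
  walk⇒path nil = nil , [] ∷ []
  walk⇒path {x} (cons e j w) with walk⇒path w
  ... | p , u with x ∈? visited p
  ...   | yes x∈p = path-suffix p u x∈p
  ...   | no  x∉p = cons e j p , ¬Any⇒All¬ _ x∉p ∷ u

  start∈visited : ∀ {x y} (w : Walk x y) → x ∈ visited w
  start∈visited nil          = here refl
  start∈visited (cons _ _ _) = here refl

  joins⇒incident : ∀ {e x y} → Joins e x y → Incident x e
  joins⇒incident (inj₁ (p , _)) = inj₁ p
  joins⇒incident (inj₂ (_ , p)) = inj₂ p

  incident⇒visited : ∀ {x y z e} (w : Walk x y) → e ∈ edges w → Incident z e → z ∈ visited w
  incident⇒visited (cons _ j w) (there e∈w) i = there (incident⇒visited w e∈w i)
  incident⇒visited (cons _ (inj₁ (refl , refl)) w) (here refl) (inj₁ refl) = here refl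
  incident⇒visited (cons _ (inj₁ (refl , refl)) w) (here refl) (inj₂ refl) = there (start∈visited w)
  incident⇒visited (cons _ (inj₂ (refl , refl)) w) (here refl) (inj₁ refl) = there (start∈visited w)
  incident⇒visited (cons _ (inj₂ (refl , refl)) w) (here refl) (inj₂ refl) = here refl

  -- If the first edge occurred again, its start `x` would be visited again.
  path-edges-unique : ∀ {x y} (p : Walk x y) → IsPath p → Unique (edges p)
  path-edges-unique nil          _         = []
  path-edges-unique (cons e j p) (x≢p ∷ u) =
    ¬Any⇒All¬ _ (λ e∈p → lookup x≢p (incident⇒visited p e∈p (joins⇒incident j)) refl)
    ∷ path-edges-unique p u

  -- When an edge from `y` back to `x` closes the path, the resulting cycle is based at `y`, so the
  -- last vertex has to be listed first.
  path-end-unique : ∀ {x y} (p : Walk x y) → IsPath p → Unique (y ∷ vertices p)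
  path-end-unique {y = y} p =
    Permutation.Unique-resp-↭ (setoid Vertex) (↭⇒↭ₛ (↭-sym (∷↭∷ʳ y (vertices p))))

-- The first condition makes `ℓ` constant on components, the second separates different ones.
-- Comparing labels thus decides whether two vertices are connected.
ComponentLabelling : Graph → Set
ComponentLabelling G = Σ[ ℓ ∈ (Vertex → Vertex) ]
  (∀ e → ℓ (end₁ e) ≡ ℓ (end₂ e)) × (∀ {x y} → ℓ x ≡ ℓ y → Walk x y)
  where open Graph G

-- Deleting and restoring one edge

module _ {s t : Fin (suc n) → Fin o} {s≢t : ∀ e → s e ≢ t e} where
  private
    G G⁻ : Graph
    G  = graph s t s≢t
    G⁻ = graph (s ∘ suc) (t ∘ suc) (s≢t ∘ suc)
    module G  = Graph G
    module G⁻ = Graph G⁻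
    u = s zero
    v = t zero

  lift : ∀ {x y} → G⁻.Walk x y → G.Walk x y
  lift G⁻.nil          = G.nil
  lift (G⁻.cons e j w) = G.cons (suc e) j (lift w)

  edges-lift : ∀ {x y} (w : G⁻.Walk x y) → G.edges (lift w) ≡ map suc (G⁻.edges w)
  edges-lift G⁻.nil          = refl
  edges-lift (G⁻.cons e j w) = cong (suc e ∷_) (edges-lift w)

  vertices-lift : ∀ {x y} (w : G⁻.Walk x y) → G.vertices (lift w) ≡ G⁻.vertices w
  vertices-lift G⁻.nil          = refl
  vertices-lift (G⁻.cons e j w) = cong (_ ∷_) (vertices-lift w)

  edges-lift-unique : ∀ {x y} (w : G⁻.Walk x y) → Unique (G⁻.edges w) → Unique (G.edges (lift w))
  edges-lift-unique w = subst Unique (sym (edges-lift w)) ∘ Unique.map⁺ suc-injective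

  acyclic-delete : G.Acyclic → G⁻.Acyclic
  acyclic-delete acyclic (G⁻.cons e j w) (_ , ue , uv) =
    acyclic (lift w⁺) (s≤s z≤n , edges-lift-unique w⁺ ue , subst Unique (sym (vertices-lift w⁺)) uv)
    where w⁺ = G⁻.cons e j w

  -- A path from `u` to `v` in `G⁻` together with edge `zero`, run from `v` to `u`, would be a
  -- cycle: the lifted edges are all successors, hence different from `zero`.
  acyclic⇒ends-separated : G.Acyclic → ¬ G⁻.Walk u v
  acyclic⇒ends-separated acyclic w with walk⇒path w
  ... | p , path = acyclic (G.cons zero (inj₂ (refl , refl)) (lift p))
    ( s≤s z≤n
    , subst (All (zero ≢_)) (sym (edges-lift p)) (map⁺ (universal (λ _ ()) _))
      ∷ edges-lift-unique p (path-edges-unique p path)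
    , subst (Unique ∘ (v ∷_)) (sym (vertices-lift p)) (path-end-unique p path) )

  -- The restored edge unites the components of `u` and `v`, so the label of `v` is replaced by that
  -- of `u`.
  labelling-extend : ComponentLabelling G⁻ → ComponentLabelling G
  labelling-extend (ℓ , constant , connect) = merge ∘ ℓ , constant′ , connect′
    where
    merge : Fin o → Fin o
    merge k = if does (k ≟ ℓ v) then ℓ u else k

    merge-ends : merge (ℓ u) ≡ merge (ℓ v)
    merge-ends rewrite dec-true (ℓ v ≟ ℓ v) refl with does (ℓ u ≟ ℓ v)
    ... | true  = refl
    ... | false = refl

    constant′ : ∀ e → merge (ℓ (s e)) ≡ merge (ℓ (t e))
    constant′ zero    = merge-ends
    constant′ (suc e) = cong merge (constant e)

    connect′ : ∀ {x y} → merge (ℓ x) ≡ merge (ℓ y) → G.Walk x y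
    connect′ {x} {y} eq with ℓ x ≟ ℓ v | ℓ y ≟ ℓ v
    ... | yes x~v | yes y~v = lift (connect (trans x~v (sym y~v)))
    -- Here `eq` has become `ℓ u ≡ ℓ y`: the walk goes from `x` to `v`, crosses edge `zero` to `u`
    -- and continues to `y`. The next case is its mirror image.
    ... | yes x~v | no  _   = lift (connect x~v) ⁀ G.cons zero (inj₂ (refl , refl)) (lift (connect eq))
    ... | no  _   | yes y~v = lift (connect eq) ⁀ G.cons zero (inj₁ (refl , refl)) (lift (connect (sym y~v)))
    ... | no  _   | no  _   = lift (connect eq)

component-labelling : ∀ G → ComponentLabelling G
component-labelling = edge-induction ComponentLabelling
  ((λ x → x) , (λ ()) , λ { refl → Graph.nil }) labelling-extend

-- Counting with two colours

∩-tabulate-cong : ∀ {f g h : Fin n → Bool} → (∀ e → f e ≡ true → g e ≡ h e) →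
                  tabulate f ∩ tabulate g ≡ tabulate f ∩ tabulate h
∩-tabulate-cong {n = 0} eq = refl
∩-tabulate-cong {n = suc _} {f} {g} {h} eq with ∩-tabulate-cong {f = f ∘ suc} (eq ∘ suc)
... | ih with f zero in f₀
...   | true  = cong₂ Vec._∷_ (eq zero f₀) ih
...   | false = cong (false Vec.∷_) ih

∣∩∣-complement : ∀ {f g h : Fin n → Bool} → (∀ e → h e ≡ not (g e)) →
  ∣ tabulate f ∣ ≡ ∣ tabulate f ∩ tabulate g ∣ + ∣ tabulate f ∩ tabulate h ∣
∣∩∣-complement {n = 0} eq = refl
∣∩∣-complement {n = suc _} {f} {g} {h} eq with ∣∩∣-complement {f = f ∘ suc} (eq ∘ suc)
... | ih with f zero
...   | false = ih
...   | true rewrite eq zero with g zero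
...     | true  = cong suc ih
...     | false = trans (cong suc ih) (sym (+-suc _ _))

opposite-≢ : (a : Fin 2) → opposite a ≢ a
opposite-≢ zero       ()
opposite-≢ (suc zero) ()

≢⇒≡opposite : (a b : Fin 2) → a ≢ b → b ≡ opposite a
≢⇒≡opposite zero       zero       a≢b = contradiction refl a≢b
≢⇒≡opposite zero       (suc zero) a≢b = refl
≢⇒≡opposite (suc zero) zero       a≢b = refl
≢⇒≡opposite (suc zero) (suc zero) a≢b = contradiction refl a≢b

does-≟-opposite : (a b : Fin 2) → does (a ≟ opposite b) ≡ not (does (a ≟ b))
does-≟-opposite zero       zero       = refl
does-≟-opposite zero       (suc zero) = refl
does-≟-opposite (suc zero) zero       = refl
does-≟-opposite (suc zero) (suc zero) = refl

does-opposite-≟ : (a b : Fin 2) → does (opposite a ≟ b) ≡ does (a ≟ opposite b)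
does-opposite-≟ zero       zero       = refl
does-opposite-≟ zero       (suc zero) = refl
does-opposite-≟ (suc zero) zero       = refl
does-opposite-≟ (suc zero) (suc zero) = refl

-- Balanced 2-colourings

module _ (G : Graph) where
  open Graph G

  count : (Edge → Fin 2) → Vertex → Fin 2 → ℕ
  count c x a = ∣ E x ∩ colourClass G c a ∣

  -- Exactly when x stays balanced on giving one more edge at x the colour a.
  data Fits (c : Edge → Fin 2) (x : Vertex) (a : Fin 2) : Set where
    tied   : count c x a ≡ count c x (opposite a) → Fits c x a
    behind : count c x (opposite a) ≡ suc (count c x a) → Fits c x a

  -- Some colour fits at `x` exactly when the two counts at `x` differ by at most one.
  Balanced : (Edge → Fin 2) → Set
  Balanced c = ∀ x → ∃[ a ] Fits c x a

module _ {G : Graph} where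
  open Graph G

  does-incident : ∀ {x e} → does (incident? x e) ≡ true → Incident x e
  does-incident {x} {e} eq = invert (subst (Reflects _) eq (proof (incident? x e)))

  count-cong : ∀ c c′ {x a a′} → (∀ e → Incident x e → does (c e ≟ a) ≡ does (c′ e ≟ a′)) →
               count G c x a ≡ count G c′ x a′
  count-cong c c′ eq = cong ∣_∣ (∩-tabulate-cong λ e → eq e ∘ does-incident)

  degree-count : ∀ c x a → ∣ E x ∣ ≡ count G c x a + count G c x (opposite a)
  degree-count c x a = ∣∩∣-complement {f = λ e → does (incident? x e)} λ e → does-≟-opposite (c e) a

  fits-map : ∀ {c c′ x a a′} → count G c x a ≡ count G c′ x a′ →
             count G c x (opposite a) ≡ count G c′ x (opposite a′) → Fits G c x a → Fits G c′ x a′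
  fits-map p q (tied eq)   = tied (trans (sym p) (trans eq q))
  fits-map p q (behind eq) = behind (trans (sym q) (trans eq (cong suc p)))

  fits-cong : ∀ {c c′ x a} → (∀ e → Incident x e → c e ≡ c′ e) → Fits G c x a → Fits G c′ x a
  fits-cong {c} {c′} {x} eq = fits-map (same _) (same _)
    where
    same : ∀ b → count G c x b ≡ count G c′ x b
    same b = count-cong c c′ λ e i → cong (λ k → does (k ≟ b)) (eq e i)

  -- Exchanging the colours of all edges turns the count of each colour into that of its opposite.
  fits-opposite : ∀ {c x a} → Fits G c x a → Fits G (opposite ∘ c) x (opposite a)
  fits-opposite {c} {x} = fits-map (swap _) (swap _)
    where
    swap : ∀ b → count G c x b ≡ count G (opposite ∘ c) x (opposite b)
    swap b = count-cong c (opposite ∘ c) λ e _ → sym (trans (does-opposite-≟ (c e) (opposite b))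
      (cong (λ k → does (c e ≟ k)) (opposite-involutive b)))

  -- A tie means even degree, with remainder 0 and no colour in excess. Otherwise the degree is odd,
  -- and the one colour in excess is the opposite of the colour lagging behind.
  balanced⇒homogeneous : ∀ {c} → Balanced G c → IsHomogeneous G 2 c
  balanced⇒homogeneous {c} bal x with bal x
  ... | a , tied tie =
    count G c x a , 0 ,
    trans (degree-count c x a) (trans (cong (count G c x a +_) (sym tie)) (double (count G c x a))) ,
    s≤s z≤n , ⊥ , ∣⊥∣≡0 2 , (λ s s∈⊥ → contradiction s∈⊥ ∉⊥) , λ s _ → equal s
    where
    double : ∀ m → m + m ≡ 2 * m + 0
    double = solve-∀
    equal : ∀ s → count G c x s ≡ count G c x a
    equal s with a ≟ s
    ... | yes refl = refl
    ... | no  a≢s rewrite ≢⇒≡opposite a s a≢s = sym tie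
  ... | a , behind lag =
    count G c x a , 1 ,
    trans (degree-count c x a) (trans (cong (count G c x a +_) lag) (double+1 (count G c x a))) ,
    s≤s (s≤s z≤n) , ⁅ opposite a ⁆ , ∣⁅x⁆∣≡1 (opposite a) ,
    (λ s s∈ → trans (cong (count G c x) (x∈⁅y⁆⇒x≡y _ s∈)) lag) , minority
    where
    double+1 : ∀ m → m + suc m ≡ 2 * m + 1
    double+1 = solve-∀
    minority : ∀ s → s ∉ₛ ⁅ opposite a ⁆ → count G c x s ≡ count G c x a
    minority s s∉ with a ≟ s
    ... | yes refl = refl
    ... | no  a≢s  = contradiction (subst (_∈ₛ _) (sym (≢⇒≡opposite a s a≢s)) (x∈⁅x⁆ _)) s∉

  -- At each vertex either all edges are exchanged or none, so balance survives everywhere. The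
  -- vertex `u` lies outside the exchanged component, since equal labels would yield a walk to `v`.
  exchange-component : ∀ {u v} → ¬ Walk u v → (c : Edge → Fin 2) → Balanced G c →
    ∀ {a b} → Fits G c u a → Fits G c v b →
    ∃[ c′ ] Balanced G c′ × Fits G c′ u a × Fits G c′ v (opposite b)
  exchange-component {u} {v} u≁v c bal fu fv with component-labelling G
  ... | ℓ , constant , connect = c′ , bal′ , outside (u≁v ∘ connect) fu , inside refl fv
    where
    c′ : Edge → Fin 2
    -- Both ends of `e` carry the same label, so testing one of them is enough.
    c′ e = if does (ℓ (end₁ e) ≟ ℓ v) then opposite (c e) else c e

    label : ∀ {x e} → Incident x e → ℓ (end₁ e) ≡ ℓ x
    label         (inj₁ refl) = refl
    label {e = e} (inj₂ refl) = constant e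

    inside : ∀ {x a} → ℓ x ≡ ℓ v → Fits G c x a → Fits G c′ x (opposite a)
    inside x~v = fits-cong (λ e i → sym (cong (if_then opposite (c e) else c e)
      (dec-true (ℓ (end₁ e) ≟ ℓ v) (trans (label i) x~v)))) ∘ fits-opposite

    outside : ∀ {x a} → ℓ x ≢ ℓ v → Fits G c x a → Fits G c′ x a
    outside x≁v = fits-cong λ e i → sym (cong (if_then opposite (c e) else c e)
      (dec-false (ℓ (end₁ e) ≟ ℓ v) (x≁v ∘ trans (sym (label i)))))

    bal′ : Balanced G c′
    bal′ x with ℓ x ≟ ℓ v | bal x
    ... | yes x~v | a , f = opposite a , inside x~v f
    ... | no  x≁v | a , f = a , outside x≁v f

  common-fit : ∀ {u v} → ¬ Walk u v → ∃[ c ] Balanced G c →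
               ∃[ c ] Balanced G c × ∃[ a ] Fits G c u a × Fits G c v a
  common-fit {u} {v} u≁v (c , bal) with bal u | bal v
  ... | a , fu | b , fv with a ≟ b
  ...   | yes refl = c , bal , a , fu , fv
  ...   | no  a≢b with exchange-component u≁v c bal fu fv
  ...     | c′ , bal′ , fu′ , fv′ =
    c′ , bal′ , a , fu′ , subst (Fits G c′ v) (sym (≢⇒≡opposite b a (a≢b ∘ sym))) fv′

-- Colouring the restored edge

module _ {s t : Fin (suc n) → Fin o} {s≢t : ∀ e → s e ≢ t e} where
  private
    G G⁻ : Graph
    G  = graph s t s≢t
    G⁻ = graph (s ∘ suc) (t ∘ suc) (s≢t ∘ suc)
    module G = Graph G

  module _ {c : Fin n → Fin 2} {a : Fin 2} {x : Fin o} where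
    count-extend-away : ∀ {b} → ¬ G.Incident x zero → count G (a ◁ c) x b ≡ count G⁻ c x b
    count-extend-away ¬i rewrite dec-false (G.incident? x zero) ¬i = refl

    count-extend-same : G.Incident x zero → count G (a ◁ c) x a ≡ suc (count G⁻ c x a)
    count-extend-same i rewrite dec-true (G.incident? x zero) i | dec-true (a ≟ a) refl = refl

    count-extend-opposite : G.Incident x zero →
      count G (a ◁ c) x (opposite a) ≡ count G⁻ c x (opposite a)
    count-extend-opposite i
      rewrite dec-true (G.incident? x zero) i | dec-false (a ≟ opposite a) (opposite-≢ a ∘ sym) = refl

    fits-extend-away : ∀ {b} → ¬ G.Incident x zero → Fits G⁻ c x b → Fits G (a ◁ c) x b
    fits-extend-away ¬i (tied eq)   = tied (trans (count-extend-away ¬i) (trans eq (sym (count-extend-away ¬i))))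
    fits-extend-away ¬i (behind eq) = behind (trans (count-extend-away ¬i)
      (trans eq (cong suc (sym (count-extend-away ¬i)))))

    -- After a tie, `a` takes the lead by one and the opposite colour fits next. If `a` was behind,
    -- it draws level; both colours then fit, and `a` is chosen.
    fits-extend-incident : G.Incident x zero → Fits G⁻ c x a → ∃[ b ] Fits G (a ◁ c) x b
    fits-extend-incident i (tied tie) = opposite a , behind (begin
      count G (a ◁ c) x (opposite (opposite a))  ≡⟨ cong (count G (a ◁ c) x) (opposite-involutive a) ⟩
      count G (a ◁ c) x a                        ≡⟨ count-extend-same i ⟩
      suc (count G⁻ c x a)                       ≡⟨ cong suc tie ⟩
      suc (count G⁻ c x (opposite a))            ≡⟨ cong suc (count-extend-opposite i) ⟨
      suc (count G (a ◁ c) x (opposite a))       ∎)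
      where open ≡-Reasoning
    fits-extend-incident i (behind lag) = a , tied (begin
      count G (a ◁ c) x a             ≡⟨ count-extend-same i ⟩
      suc (count G⁻ c x a)            ≡⟨ lag ⟨
      count G⁻ c x (opposite a)       ≡⟨ count-extend-opposite i ⟨
      count G (a ◁ c) x (opposite a)  ∎)
      where open ≡-Reasoning

  balanced-extend : ∀ {c a} → Balanced G⁻ c → Fits G⁻ c (s zero) a → Fits G⁻ c (t zero) a →
                    Balanced G (a ◁ c)
  balanced-extend bal fu fv x with G.incident? x zero
  ... | yes i@(inj₁ refl) = fits-extend-incident i fu
  ... | yes i@(inj₂ refl) = fits-extend-incident i fv
  ... | no ¬i with bal x
  ...   | b , f = b , fits-extend-away ¬i f

balanced-colouring : ∀ G → Graph.Acyclic G → ∃[ c ] Balanced G c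
balanced-colouring = edge-induction _
  -- Without edges both counts are 0 at every vertex; the colour `zero` is an arbitrary choice.
  (λ _ → (λ ()) , λ _ → zero , tied refl)
  λ ih acyclic →
    let c , bal , a , fu , fv = common-fit (acyclic⇒ends-separated acyclic) (ih (acyclic-delete acyclic))
    in a ◁ c , balanced-extend bal fu fv

theorem4p1 : (G : Graph) → Graph.IsTree G → 3 ≤ Graph.order G → HomogeneousChromaticIndex G 2
theorem4p1 G (_ , acyclic) _ with balanced-colouring G acyclic
-- Minimality is immediate, as only values of at least 2 compete.
... | c , bal = (s≤s (s≤s z≤n) , c , balanced⇒homogeneous bal) , λ _ 2≤k _ → 2≤k
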